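{- Let $T$ be one of the following finite $2$-transitive permutation groups on $Q=\{1,\ldots,q\}$, in its natural $2$-transitive action of the stated degree $q$: $S_6$ or $A_6$ ($q=6$); $\mathrm{PSL}(2,11)$ ($q=11$); $M_{12}$ ($q=12$); $A_7$ ($q=15$); $HS$ ($q=176$); or a group $T$ with $\mathrm{PSL}(n,\ell)\leq T\leq\mathrm{P\Gamma L}(n,\ell)$, $n>2$, $\ell$ a prime power, acting on the $q=(\ell^n-1)/(\ell-1)$ one-dimensional subspaces of $\mathbb{F}_\ell^n$. Let $\mathcal{I}=(\rho_1,\rho_2)$ where $\rho_1$ is the identity map of $T$ and $\rho_2$ is an outer automorphism of $T$, not induced by conjugation by an element of $N_{S_q}(T)$, with $\rho_2^2=\rho_1$ (both viewed as homomorphisms $T\to S_q$). Then the code $C(T,\mathcal{I})$ is neighbour transitive in the Hamming graph $H(2q,q)$.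
   Context: $S_q=\mathrm{Sym}(Q)$, acting on the right; $t\rho$ denotes the image of $t$ under $\rho$. For a homomorphism $\rho:T\to S_q$ put $\alpha(t,\rho)=(1^{t\rho},\ldots,q^{t\rho})\in Q^q$, and let $C(T,\mathcal{I})=\{(\alpha(t,\rho_1),\alpha(t,\rho_2)):t\in T\}\subseteq Q^{2q}$. The Hamming graph $H(m,q)$ has vertex set $Q^m$, two vertices being adjacent iff they differ in exactly one entry; its distance is the Hamming distance $d$, and its automorphism group is $S_q^m\rtimes S_m$ (permuting letters independently in each coordinate, and permuting coordinates). For a code $C\subseteq Q^m$, an automorphism of $C$ is an automorphism of $H(m,q)$ fixing $C$ setwise. For a vertex $\nu$ let $d(\nu,C)=\min\{d(\nu,\beta):\beta\in C\}$, and let $C_1=\{\nu:d(\nu,C)=1\}$ be the set of neighbours of $C$. $C$ is neighbour transitive if there is a group $G$ of automorphisms of $C$ such that both $C$ and $C_1$ are $G$-orbits. For these groups it is known that the subgroup of $\mathrm{Aut}(T)$ induced by conjugation by $N_{S_q}(T)$ has index $2$ in $\mathrm{Aut}(T)$. -}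

module Defs where

open import Algebra.Bundles using (CommutativeRing; Group)
open import Algebra.Morphism.Structures
  using (IsGroupIsomorphism; IsGroupMonomorphism; IsRingIsomorphism)
import Algebra.Properties.Semiring.Exp as Exp
import Algebra.Properties.Semiring.Sum as Sum
open import Data.Empty using (⊥-elim)
open import Data.Fin as Fin using (Fin; zero; suc; toℕ; punchIn)
open import Data.Fin.Permutation as Perm using (Permutation′)
open import Data.Fin.Permutation.Transposition.List using (TranspositionList; eval)
open import Data.Fin.Subset as Subset using (Subset; ∣_∣)
open import Data.List.Base using (length)
open import Data.List.Relation.Unary.All using (All)
open import Data.Nat as ℕ using (ℕ; zero; suc)
open import Data.Nat.Divisibility using (_∣_)
open import Data.Nat.Primality using (Prime)
open import Data.Product using (Σ; ∃; ∃!; _×_; _,_; proj₁; proj₂)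
open import Data.Vec as Vec using (Vec; []; _∷_; concat; count; lookup; tabulate; zip)
open import Data.Vec.Functional using (Vector)
import Data.Vec.Functional.Relation.Binary.Equality.Setoid as VectorEq
open import Function.Base using (_∘_)
open import Function.Bundles using (Inverse; _↔_; _⇔_)
open import Function.Construct.Composition using (_↔-∘_)
open import Function.Construct.Identity using (↔-id)
open import Function.Construct.Symmetry using (↔-sym)
open import Function.Definitions using (Bijective)
open import Level using (0ℓ)
open import Relation.Binary using (Rel; Setoid; Symmetric)
open import Relation.Binary.PropositionalEquality as ≡ using (_≡_; _≢_; refl)
import Relation.Binary.Reasoning.Setoid as SetoidReasoning
open import Relation.Nullary using (¬_; ¬?; yes; no)
open import Relation.Unary using (Pred; _∈_; _⊆_)

------------------------------------------------------------------------
-- Permutation groups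

infixl 20 _·_

-- Image of a point; permutations act on the right.
_·_ : {V W : Set} → V → V ↔ W → W
v · f = Inverse.to f v

-- `f ∙ g` is "first f, then g".
Sym : Set → Group 0ℓ 0ℓ
Sym V = record
  { Carrier = V ↔ V
  ; _≈_     = λ f g → ∀ v → v · f ≡ v · g
  ; _∙_     = λ f g → g ↔-∘ f
  ; ε       = ↔-id V
  ; _⁻¹     = ↔-sym
  ; isGroup = record
    { isMonoid = record
      { isSemigroup = record
        { isMagma = record
          { isEquivalence = record
            { refl  = λ _ → refl
            ; sym   = λ p v → ≡.sym (p v)
            ; trans = λ p q v → ≡.trans (p v) (q v)
            }
          ; ∙-cong = λ {_} {_} {g} p q v → ≡.trans (≡.cong (_· g) (p v)) (q _)
          }
        ; assoc = λ _ _ _ _ → refl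
        }
      ; identity = (λ _ _ → refl) , (λ _ _ → refl)
      }
    ; inverse = (λ f _ → Inverse.inverseˡ f refl) , (λ f _ → Inverse.inverseʳ f refl)
    ; ⁻¹-cong = λ {f} {g} p v →
        ≡.trans (≡.sym (Inverse.inverseʳ g refl))
          (≡.cong (Inverse.from g)
            (≡.trans (≡.sym (p (Inverse.from f v))) (Inverse.inverseˡ f refl)))
    }
  }

record Subgroup (G : Group 0ℓ 0ℓ) : Set₁ where
  open Group G
  field
    Member    : Pred Carrier 0ℓ
    resp      : ∀ {x y} → x ≈ y → Member x → Member y
    ε-closed  : Member ε
    ∙-closed  : ∀ {x y} → Member x → Member y → Member (x ∙ y)
    ⁻¹-closed : ∀ {x} → Member x → Member (x ⁻¹)

  Element : Set
  Element = Σ Carrier Member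

  group : Group 0ℓ 0ℓ
  group = record
    { Carrier = Element
    ; _≈_     = λ x y → proj₁ x ≈ proj₁ y
    ; _∙_     = λ x y → (proj₁ x ∙ proj₁ y) , ∙-closed (proj₂ x) (proj₂ y)
    ; ε       = ε , ε-closed
    ; _⁻¹     = λ x → (proj₁ x ⁻¹) , ⁻¹-closed (proj₂ x)
    ; isGroup = record
      { isMonoid = record
        { isSemigroup = record
          { isMagma = record
            { isEquivalence = record { refl = Group.refl G ; sym = Group.sym G ; trans = Group.trans G }
            ; ∙-cong = ∙-cong
            }
          ; assoc = λ x y z → assoc (proj₁ x) (proj₁ y) (proj₁ z)
          }
        ; identity = (λ x → identityˡ (proj₁ x)) , (λ x → identityʳ (proj₁ x))
        }
      ; inverse = (λ x → inverseˡ (proj₁ x)) , (λ x → inverseʳ (proj₁ x))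
      ; ⁻¹-cong = ⁻¹-cong
      }
    }

-- `T ≅ X`: T is isomorphic to the group X of permutations of W.  X is given
-- by its set of elements, which is exactly the image of a monomorphism.
_≅_ : {G : Group 0ℓ 0ℓ} {W : Set} → Subgroup G → Pred (W ↔ W) 0ℓ → Set
_≅_ {W = W} T X =
  Σ (Element → W ↔ W) λ φ →
    IsGroupMonomorphism (Group.rawGroup group) (Group.rawGroup (Sym W)) φ ×
    (∀ π → X π ⇔ ∃ λ t → φ t ≈ π)
  where
  open Subgroup T
  open Group (Sym W) using (_≈_)

TwoTransitive : {V : Set} → Subgroup (Sym V) → Set
TwoTransitive {V} T = ∀ (i j k l : V) → i ≢ j → k ≢ l →
  ∃ λ t → t ∈ Member × i · t ≡ k × j · t ≡ l
  where open Subgroup T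

IsOrbit : {V : Set} → Subgroup (Sym V) → Pred V 0ℓ → Set
IsOrbit G S = ∃ λ u → ∀ v → S v ⇔ ∃ λ g → g ∈ Member × u · g ≡ v
  where open Subgroup G

------------------------------------------------------------------------
-- Automorphisms

IsAutomorphism : {G : Group 0ℓ 0ℓ} (T : Subgroup G) → (Subgroup.Element T → Subgroup.Element T) → Set
IsAutomorphism T = IsGroupIsomorphism rawGroup rawGroup
  where open Group (Subgroup.group T) using (rawGroup)

module _ {G : Group 0ℓ 0ℓ} (T : Subgroup G) where
  open Group G
  open Subgroup T

  Normalizes : Carrier → Set
  Normalizes g = ∀ x → Member x ⇔ Member (g ⁻¹ ∙ x ∙ g)

  InducedBy : (Element → Element) → Carrier → Set
  InducedBy τ g = ∀ t → proj₁ (τ t) ≈ g ⁻¹ ∙ proj₁ t ∙ g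

  Outer : (Element → Element) → Set
  Outer τ = ¬ ∃ λ s → s ∈ Member × InducedBy τ s

  InducedByNormalizer : (Element → Element) → Set
  InducedByNormalizer τ = ∃ λ g → Normalizes g × InducedBy τ g

  SquaresToIdentity : (Element → Element) → Set
  SquaresToIdentity τ = ∀ t → proj₁ (τ (τ t)) ≈ proj₁ t

------------------------------------------------------------------------
-- Graphs

record Graph (V : Set) : Set₁ where
  field
    Adj    : Rel V 0ℓ
    sym    : Symmetric Adj
    irrefl : ∀ {v} → ¬ Adj v v

IsGraphAutomorphism : {V : Set} → Graph V → Pred (V ↔ V) 0ℓ
IsGraphAutomorphism Γ f = ∀ u v → Adj u v ⇔ Adj (u · f) (v · f)
  where open Graph Γ

record IsStronglyRegular {v : ℕ} (Γ : Graph (Fin v)) (k l m : ℕ) : Set where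
  open Graph Γ
  field
    nbhd        : Fin v → Subset v
    nbhd-Adj    : ∀ i j → j Subset.∈ nbhd i ⇔ Adj i j
    regular     : ∀ i → ∣ nbhd i ∣ ≡ k
    adjacent    : ∀ i j → Adj i j → ∣ nbhd i Subset.∩ nbhd j ∣ ≡ l
    nonadjacent : ∀ i j → i ≢ j → ¬ Adj i j → ∣ nbhd i Subset.∩ nbhd j ∣ ≡ m

------------------------------------------------------------------------
-- Codes in Hamming graphs

Vertex : ℕ → ℕ → Set
Vertex m q = Vec (Fin q) m

d : ∀ {m q} → Vertex m q → Vertex m q → ℕ
d u v = count (λ (x , y) → ¬? (x Fin.≟ y)) (zip u v)

d-sym : ∀ {m q} (u v : Vertex m q) → d u v ≡ d v u
d-sym []      []      = refl
d-sym (x ∷ u) (y ∷ v) with x Fin.≟ y | y Fin.≟ x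
... | yes _ | yes _ = d-sym u v
... | no  _ | no  _ = ≡.cong suc (d-sym u v)
... | yes p | no ¬p = ⊥-elim (¬p (≡.sym p))
... | no ¬p | yes p = ⊥-elim (¬p (≡.sym p))

d-refl : ∀ {m q} (u : Vertex m q) → d u u ≡ 0
d-refl []      = refl
d-refl (x ∷ u) with x Fin.≟ x
... | yes _ = d-refl u
... | no ¬p = ⊥-elim (¬p refl)

H : ∀ m q → Graph (Vertex m q)
H m q = record
  { Adj    = λ u v → d u v ≡ 1
  ; sym    = λ {u} {v} → ≡.trans (d-sym v u)
  ; irrefl = λ {v} p → 0≢1 (≡.trans (≡.sym (d-refl v)) p)
  }
  where
  0≢1 : 0 ≢ 1
  0≢1 ()

Code : ℕ → ℕ → Set₁
Code m q = Pred (Vertex m q) 0ℓ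

DistanceTo : ∀ {m q} → Code m q → Vertex m q → ℕ → Set
DistanceTo C ν k = (∃ λ β → β ∈ C × d ν β ≡ k) × (∀ β → β ∈ C → k ℕ.≤ d ν β)

Neighbours : ∀ {m q} → Code m q → Code m q
Neighbours C ν = DistanceTo C ν 1

IsCodeAutomorphism : ∀ {m q} → Code m q → Pred (Vertex m q ↔ Vertex m q) 0ℓ
IsCodeAutomorphism {m} {q} C f =
  IsGraphAutomorphism (H m q) f × (∀ v → C v ⇔ C (v · f))

NeighbourTransitive : ∀ {m q} → Code m q → Set₁
NeighbourTransitive {m} {q} C =
  Σ (Subgroup (Sym (Vertex m q))) λ G →
    Subgroup.Member G ⊆ IsCodeAutomorphism C × IsOrbit G C × IsOrbit G (Neighbours C)

α : ∀ {q} {T : Set} → T → (T → Permutation′ q) → Vertex q q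
α t ρ = tabulate (λ i → i · ρ t)

-- The code {(α(t,ρ₁), …, α(t,ρₖ)) : t ∈ T}, as a subset of Q^(kq).
C⟨_,_⟩ : ∀ {k q} (T : Subgroup (Sym (Fin q))) →
         Vec (Subgroup.Element T → Permutation′ q) k → Code (k ℕ.* q) q
C⟨ T , ρs ⟩ v = ∃ λ (t : Subgroup.Element T) → v ≡ concat (Vec.map (α t) ρs)

------------------------------------------------------------------------
-- Finite fields, PSL and PΓL

record FiniteField (order : ℕ) : Set₁ where
  field
    commutativeRing : CommutativeRing 0ℓ 0ℓ
  open CommutativeRing commutativeRing public
  field
    1≉0         : ¬ 1# ≈ 0#
    reciprocal  : ∀ x → ¬ x ≈ 0# → ∃ λ y → x * y ≈ 1#
    enumeration : Inverse setoid (≡.setoid (Fin order))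

PrimePower : ℕ → Set
PrimePower l = ∃ λ p → ∃ λ k → Prime p × l ≡ p ℕ.^ suc k

module Projective {l : ℕ} (F : FiniteField l) where
  open FiniteField F hiding (zero)
  open Sum semiring using (sum)
  open Exp semiring using (_^_)
  open VectorEq setoid public using (_≋_)

  0ᵛ : ∀ {n} → Vector Carrier n
  0ᵛ _ = 0#

  infixl 7 _∗_
  _∗_ : ∀ {n} → Carrier → Vector Carrier n → Vector Carrier n
  (c ∗ v) i = c * v i

  infixl 6 _⊕_
  _⊕_ : ∀ {n} → Vector Carrier n → Vector Carrier n → Vector Carrier n
  (u ⊕ v) i = u i + v i

  -- Equality of the spans ⟨u⟩ and ⟨v⟩, for u and v nonzero.
  infix 4 _∼_
  _∼_ : ∀ {n} → Vector Carrier n → Vector Carrier n → Set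
  u ∼ v = ∃ λ c → ¬ c ≈ 0# × u ≋ c ∗ v

  private
    open SetoidReasoning setoid

    unit≉0 : ∀ {x y} → x * y ≈ 1# → ¬ x ≈ 0#
    unit≉0 {x} {y} xy≈1 x≈0 = 1≉0 (trans (sym xy≈1) (trans (*-congʳ x≈0) (zeroˡ y)))

    ∼-refl : ∀ {n} {u : Vector Carrier n} → u ∼ u
    ∼-refl = 1# , 1≉0 , λ i → sym (*-identityˡ _)

    ∼-sym : ∀ {n} {u v : Vector Carrier n} → u ∼ v → v ∼ u
    ∼-sym {u = u} {v} (c , c≉0 , u≋cv) with reciprocal c c≉0
    ... | c′ , cc′≈1 = c′ , unit≉0 (trans (*-comm c′ c) cc′≈1) , λ i → begin
      v i              ≈⟨ *-identityˡ (v i) ⟨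
      1# * v i         ≈⟨ *-congʳ (trans (*-comm c′ c) cc′≈1) ⟨
      (c′ * c) * v i   ≈⟨ *-assoc c′ c (v i) ⟩
      c′ * (c * v i)   ≈⟨ *-congˡ (u≋cv i) ⟨
      c′ * u i         ∎

    ∼-trans : ∀ {n} {u v w : Vector Carrier n} → u ∼ v → v ∼ w → u ∼ w
    ∼-trans {u = u} {v} {w} (c , c≉0 , u≋cv) (e , e≉0 , v≋ew) =
      c * e , ce≉0 , λ i → begin
        u i            ≈⟨ u≋cv i ⟩
        c * v i        ≈⟨ *-congˡ (v≋ew i) ⟩
        c * (e * w i)  ≈⟨ *-assoc c e (w i) ⟨
        c * e * w i    ∎
      where
      ce≉0 : ¬ c * e ≈ 0#
      ce≉0 ce≈0 with reciprocal e e≉0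
      ... | e′ , ee′≈1 = c≉0 (begin
        c              ≈⟨ *-identityʳ c ⟨
        c * 1#         ≈⟨ *-congˡ ee′≈1 ⟨
        c * (e * e′)   ≈⟨ *-assoc c e e′ ⟨
        c * e * e′     ≈⟨ *-congʳ ce≈0 ⟩
        0# * e′        ≈⟨ zeroˡ e′ ⟩
        0#             ∎)

  -- The one-dimensional subspaces of Fⁿ, each represented by a spanning vector.
  Points : ℕ → Setoid 0ℓ 0ℓ
  Points n = record
    { Carrier       = Σ (Vector Carrier n) λ v → ¬ v ≋ 0ᵛ
    ; _≈_           = λ u v → proj₁ u ∼ proj₁ v
    ; isEquivalence = record { refl = ∼-refl ; sym = ∼-sym ; trans = ∼-trans }
    }

  Labelling : ℕ → ℕ → Set
  Labelling n q = Inverse (Points n) (≡.setoid (Fin q))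

  Matrix : ℕ → Set
  Matrix n = Fin n → Fin n → Carrier

  _⊗_ : ∀ {n} → Vector Carrier n → Matrix n → Vector Carrier n
  (v ⊗ A) j = sum (λ i → v i * A i j)

  det : ∀ {n} → Matrix n → Carrier
  det {zero}  A = 1#
  det {suc n} A = sum λ j → (- 1#) ^ toℕ j * A zero j * det (λ i k → A (suc i) (punchIn j k))

  record IsSemilinear {n : ℕ} (σ : Carrier → Carrier)
                      (f : Vector Carrier n → Vector Carrier n) : Set where
    field
      cong  : ∀ {u v} → u ≋ v → f u ≋ f v
      plus  : ∀ u v → f (u ⊕ v) ≋ f u ⊕ f v
      scale : ∀ c v → f (c ∗ v) ≋ σ c ∗ f v

  module _ {n q : ℕ} (L : Labelling n q) where

    vector : Fin q → Vector Carrier n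
    vector i = proj₁ (Inverse.from L i)

    -- π is the permutation of the labelled points induced by f.
    Induces : (Vector Carrier n → Vector Carrier n) → Permutation′ q → Set
    Induces f π = ∀ i → f (vector i) ∼ vector (i · π)

    PSL : Pred (Permutation′ q) 0ℓ
    PSL π = ∃ λ (A : Matrix n) → det A ≈ 1# × Induces (_⊗ A) π

    PΓL : Pred (Permutation′ q) 0ℓ
    PΓL π = ∃ λ σ → ∃ λ f →
      IsRingIsomorphism rawRing rawRing σ × IsSemilinear σ f ×
      Bijective _≋_ _≋_ f × Induces f π

------------------------------------------------------------------------
-- The other groups

Alternating : ∀ n → Pred (Permutation′ n) 0ℓ
Alternating n π = ∃ λ (ts : TranspositionList n) →
  All (λ (i , j) → i ≢ j) ts × 2 ∣ length ts × eval ts Perm.≈ π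

record SteinerSystem (t k v : ℕ) : Set₁ where
  field
    Block  : Pred (Subset v) 0ℓ
    size   : ∀ {B} → Block B → ∣ B ∣ ≡ k
    unique : ∀ S → ∣ S ∣ ≡ t → ∃! _≡_ λ B → Block B × S Subset.⊆ B

image : ∀ {n} → Permutation′ n → Subset n → Subset n
image π B = tabulate λ i → lookup B (i · ↔-sym π)

-- M₁₂ is the automorphism group of the Steiner system S(5,6,12), which is
-- unique up to isomorphism.
M₁₂ : SteinerSystem 5 6 12 → Pred (Permutation′ 12) 0ℓ
M₁₂ S π = ∀ B → Block B ⇔ Block (image π B)
  where open SteinerSystem S

-- The strongly regular graph with parameters (100,22,0,6) is unique up to
-- isomorphism (the Higman–Sims graph).  Its automorphism group is HS:2, and
-- HS is the subgroup of index 2 consisting of the even permutations.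
HS : Graph (Fin 100) → Pred (Permutation′ 100) 0ℓ
HS Γ π = IsGraphAutomorphism Γ π × Alternating 100 π

------------------------------------------------------------------------

-- The labels 1,…,q of the points are immaterial.  S₆, A₆ and the projective
-- groups are given as sets of permutations.  In the other cases the natural
-- action is that of a 2-transitive group of the stated degree and isomorphism
-- type: up to relabelling there is one such permutation group, although (as
-- for PSL(n,ℓ) on points and on hyperplanes) an abstract group may have two
-- such actions, interchanged by an outer automorphism.
data Listed : (q : ℕ) → Subgroup (Sym (Fin q)) → Set₁ where

  is-S₆ : ∀ {T} → (∀ π → π ∈ Subgroup.Member T) → Listed 6 T

  is-A₆ : ∀ {T} → (∀ π → π ∈ Subgroup.Member T ⇔ π ∈ Alternating 6) → Listed 6 T

  is-PSL[2,11] : ∀ {T} → TwoTransitive T →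
    (F : FiniteField 11) (L : Projective.Labelling F 2 12) →
    T ≅ Projective.PSL F L → Listed 11 T

  is-M₁₂ : ∀ {T} → TwoTransitive T →
    (S : SteinerSystem 5 6 12) → T ≅ M₁₂ S → Listed 12 T

  is-A₇ : ∀ {T} → TwoTransitive T → T ≅ Alternating 7 → Listed 15 T

  is-HS : ∀ {T} → TwoTransitive T →
    (Γ : Graph (Fin 100)) → IsStronglyRegular Γ 22 0 6 → T ≅ HS Γ → Listed 176 T

  is-projective : ∀ {n l q T} → 2 ℕ.< n → PrimePower l →
    q ℕ.* (l ℕ.∸ 1) ≡ l ℕ.^ n ℕ.∸ 1 →
    (F : FiniteField l) (L : Projective.Labelling F n q) →
    Projective.PSL F L ⊆ Subgroup.Member T →
    Subgroup.Member T ⊆ Projective.PΓL F L → Listed q T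

{-# OPTIONS --safe #-}

-- The only property of T that matters is 2-transitivity; of τ, that it is an
-- automorphism with τ² = 1.  For s, t ∈ T, permuting the coordinates of the two
-- halves by s and τ(s) and the letters by t and τ(t) is an automorphism of H(2q,q)
-- that takes the codeword of g to that of sgt, and interchanging the halves takes
-- the codeword of g to that of τ(g).  The former are transitive on codewords; by
-- 2-transitivity the stabiliser of the codeword of 1 permutes transitively the
-- vertices obtained from it by changing one entry of the first half, and the
-- interchange provides the second half.  The projective groups are 2-transitive
-- because transvections v ↦ v + vᵢw with wᵢ = 0 take any two independent
-- vectors to multiples of the first two basis vectors.
module Submission where

open import Defs
open import Algebra.Bundles using (Group)
open import Algebra.Morphism.Structures using (IsGroupHomomorphism; IsGroupIsomorphism)
import Algebra.Properties.Ring as RingProperties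
import Algebra.Properties.Semiring.Exp as Exp
import Algebra.Properties.Semiring.Sum as Sum
open import Data.Fin as Fin using (Fin; zero; suc; combine; opposite; punchIn; remQuot; toℕ)
open import Data.Fin.Permutation as Perm using (Permutation′)
import Data.Fin.Permutation.Components as Components
open import Data.Fin.Permutation.Transposition.List using (TranspositionList; eval)
open import Data.Fin.Properties using (all?; any?; combine-remQuot; opposite-involutive; punchInᵢ≢i; remQuot-combine)
open import Data.List.Base using (length; []; _∷_)
open import Data.List.Relation.Unary.All using (All; []; _∷_)
open import Data.Nat as ℕ using (ℕ; zero; suc; s≤s)
open import Data.Nat.Divisibility using (_∣_; divides)
open import Data.Nat.Properties using (n≢0⇒n>0; n≮0; suc-injective)
open import Data.Product using (∃; ∃₂; _×_; _,_; proj₁; proj₂; uncurry)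
open import Data.Product.Properties using (≡-dec)
open import Data.Vec as Vec using (Vec; []; _∷_; concat; lookup; tabulate)
open import Data.Vec.Functional using (Vector)
open import Data.Vec.Properties using (lookup-concat; lookup-map; lookup∘tabulate; tabulate∘lookup; tabulate-cong)
open import Function.Base using (_∘_; id)
open import Function.Bundles using (Equivalence; Inverse; _↔_; _⇔_; mk⇔; mk↔ₛ′)
open import Function.Construct.Identity using (↔-id)
open import Function.Construct.Symmetry using (↔-sym)
open import Relation.Binary using (Decidable; Setoid)
open import Relation.Binary.PropositionalEquality as ≡ using (_≡_; _≢_)
import Relation.Binary.Reasoning.Setoid as SetoidReasoning
open import Relation.Nullary using (¬_; ¬?; Dec; yes; no; contradiction; from-yes; _×-dec_)
open import Relation.Nullary.Decidable using (dec-false; dec-true; decidable-stable; map′)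
open import Relation.Unary using (_∈_; _⊆_)

-- Permutations, and ordered pairs of points related by a group

·-injective : ∀ {V W : Set} (f : V ↔ W) {x y} → x · f ≡ y · f → x ≡ y
·-injective f {x} {y} p = ≡.trans (≡.sym (Inverse.strictlyInverseʳ f x))
  (≡.trans (≡.cong (Inverse.from f) p) (Inverse.strictlyInverseʳ f y))

module _ {V : Set} (T : Subgroup (Sym V)) where
  open Subgroup T

  -- The conclusion of `TwoTransitive`, isolated as a relation between ordered pairs so that group
  -- elements can be chained through a fixed intermediate pair.
  Joined : (i j k l : V) → Set
  Joined i j k l = ∃ λ t → t ∈ Member × i · t ≡ k × j · t ≡ l

  Joined-trans : ∀ {i j k l m o} → Joined i j k l → Joined k l m o → Joined i j m o
  Joined-trans (s , s∈T , is , js) (t , t∈T , kt , lt) = Group._∙_ (Sym V) s t ,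
    ∙-closed {s} {t} s∈T t∈T ,
    ≡.trans (≡.cong (_· t) is) kt , ≡.trans (≡.cong (_· t) js) lt

  Joined-sym : ∀ {i j k l} → Joined i j k l → Joined k l i j
  Joined-sym (t , t∈T , it , jt) = ↔-sym t , ⁻¹-closed {t} t∈T ,
    ≡.trans (≡.cong (_· ↔-sym t) (≡.sym it)) (Inverse.strictlyInverseʳ t _) ,
    ≡.trans (≡.cong (_· ↔-sym t) (≡.sym jt)) (Inverse.strictlyInverseʳ t _)

  Joined-swap : ∀ {i j k l} → Joined i j k l → Joined j i l k
  Joined-swap (t , t∈T , it , jt) = t , t∈T , jt , it

-- 2-transitivity of the projective groups

module Transvections {l : ℕ} (F : FiniteField l) where
  open FiniteField F hiding (zero)
  open Projective F
  open Sum semiring using (sum; sum-cong-≋; sum-replicate-zero; *-distribʳ-sum; ∑-distrib-+)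
  open Exp semiring using (_^_)
  open RingProperties ring using (-0#≈0#)
  open SetoidReasoning setoid

  -- Field elements are compared through their positions in the finite enumeration. This makes the
  -- searches for nonzero coordinates below constructive.
  _≈?_ : Decidable _≈_
  x ≈? y = map′ injective (Inverse.to-cong enumeration) (Inverse.to enumeration x Fin.≟ Inverse.to enumeration y)
    where
    injective : Inverse.to enumeration x ≡ Inverse.to enumeration y → x ≈ y
    injective p = trans (sym (Inverse.strictlyInverseʳ enumeration x))
      (trans (Inverse.from-cong enumeration p) (Inverse.strictlyInverseʳ enumeration y))

  sum-zero : ∀ {n} (f : Vector Carrier n) → (∀ i → f i ≈ 0#) → sum f ≈ 0#
  sum-zero {n} f p = trans (sum-cong-≋ {x = f} {y = 0ᵛ} p) (sum-replicate-zero n)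

  -- Determinants of matrices that differ from the identity in one row

  minor : ∀ {n} → Matrix (suc n) → Fin (suc n) → Matrix n
  minor A j r c = A (suc r) (punchIn j c)

  laplaceTerm : ∀ {n} → Matrix (suc n) → Fin (suc n) → Carrier
  laplaceTerm A j = (- 1#) ^ toℕ j * A zero j * det (minor A j)

  laplaceTerm-zeroEntry : ∀ {n} (A : Matrix (suc n)) j → A zero j ≈ 0# → laplaceTerm A j ≈ 0#
  laplaceTerm-zeroEntry A j p = trans (*-congʳ (trans (*-congˡ p) (zeroʳ _))) (zeroˡ _)

  laplaceTerm-zeroMinor : ∀ {n} (A : Matrix (suc n)) j → det (minor A j) ≈ 0# → laplaceTerm A j ≈ 0#
  laplaceTerm-zeroMinor A j p = trans (*-congˡ p) (zeroʳ _)

  det-zeroRow : ∀ {n} (A : Matrix n) r → (∀ c → A r c ≈ 0#) → det A ≈ 0#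
  det-zeroRow {suc n} A zero    row≈0 = sum-zero (laplaceTerm A) λ j →
    laplaceTerm-zeroEntry A j (row≈0 j)
  det-zeroRow {suc n} A (suc r) row≈0 = sum-zero (laplaceTerm A) λ j →
    laplaceTerm-zeroMinor A j (det-zeroRow (minor A j) r λ c → row≈0 (punchIn j c))

  -- Induction by expansion along the top row: the first minor has the same shape and every other
  -- term vanishes.
  det-unitriangularRow : ∀ {n} (A : Matrix n) i → (∀ r → A r r ≈ 1#) →
    (∀ r c → r ≢ i → r ≢ c → A r c ≈ 0#) → det A ≈ 1#
  det-unitriangularRow {suc n} A i diagonal off-diagonal = begin
    1# * A zero zero * det (minor A zero) + sum (laplaceTerm A ∘ suc)
      ≈⟨ +-cong (*-cong (trans (*-identityˡ _) (diagonal zero)) (det-minor₀ i A diagonal off-diagonal))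
                (sum-zero (laplaceTerm A ∘ suc) (other-terms i off-diagonal)) ⟩
    1# * 1# + 0#   ≈⟨ trans (+-identityʳ _) (*-identityˡ 1#) ⟩
    1#             ∎
    where
    suc≢ : ∀ {m} {r c : Fin m} → r ≢ c → suc r ≢ suc c
    suc≢ r≢c ≡.refl = r≢c ≡.refl

    det-minor₀ : ∀ {m} i (A : Matrix (suc m)) → (∀ r → A r r ≈ 1#) →
      (∀ r c → r ≢ i → r ≢ c → A r c ≈ 0#) → det (minor A zero) ≈ 1#
    det-minor₀ {zero}  i       A diag off = refl
    -- With the exceptional row deleted, the minor is an identity matrix, so any row may be declared
    -- exceptional.
    det-minor₀ {suc m} zero    A diag off = det-unitriangularRow (minor A zero) zero (diag ∘ suc)
      (λ r c _ r≢c → off (suc r) (suc c) (λ ()) (suc≢ r≢c))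
    det-minor₀ {suc m} (suc i) A diag off = det-unitriangularRow (minor A zero) i (diag ∘ suc)
      (λ r c r≢i r≢c → off (suc r) (suc c) (suc≢ r≢i) (suc≢ r≢c))

    other-terms : ∀ i → (∀ r c → r ≢ i → r ≢ c → A r c ≈ 0#) →
      ∀ j → laplaceTerm A (suc j) ≈ 0#
    -- If the top row is the exceptional one, its entries may be nonzero, but deleting column
    -- `suc j` removes the only nonzero entry of row `suc j`, which leaves a zero row in the minor.
    other-terms zero    off j = laplaceTerm-zeroMinor A (suc j) (det-zeroRow (minor A (suc j)) j λ c →
      off (suc j) (punchIn (suc j) c) (λ ()) (punchInᵢ≢i (suc j) c ∘ ≡.sym))
    other-terms (suc i) off j = laplaceTerm-zeroEntry A (suc j) (off zero (suc j) (λ ()) (λ ()))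

  -- The identity matrix; its rows `δ i` also serve as the standard basis vectors.
  δ : ∀ {n} → Matrix n
  δ zero    zero    = 1#
  δ zero    (suc _) = 0#
  δ (suc _) zero    = 0#
  δ (suc i) (suc j) = δ i j

  δ-diagonal : ∀ {n} (i : Fin n) → δ i i ≈ 1#
  δ-diagonal zero    = refl
  δ-diagonal (suc i) = δ-diagonal i

  δ-off-diagonal : ∀ {n} {i j : Fin n} → i ≢ j → δ i j ≈ 0#
  δ-off-diagonal {i = zero}  {zero}  i≢j = contradiction ≡.refl i≢j
  δ-off-diagonal {i = zero}  {suc _} i≢j = refl
  δ-off-diagonal {i = suc _} {zero}  i≢j = refl
  δ-off-diagonal {i = suc i} {suc j} i≢j = δ-off-diagonal (i≢j ∘ ≡.cong suc)

  sum-δ : ∀ {n} (v : Vector Carrier n) j → sum (λ i → v i * δ i j) ≈ v j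
  sum-δ v zero    = trans (+-cong (*-identityʳ _) (sum-zero (λ i → v (suc i) * 0#) λ _ → zeroʳ _)) (+-identityʳ _)
  sum-δ v (suc j) = trans (+-cong (zeroʳ _) (sum-δ (v ∘ suc) j)) (+-identityˡ _)

  -- Transvections and the permutations of points that they induce

  module _ {n : ℕ} where

    -- The linear map v ↦ v + vᵢw. It becomes a transvection (or the identity) under the condition
    -- `w i ≈ 0#`, which is imposed where it is used.
    shear : Fin n → Vector Carrier n → Vector Carrier n → Vector Carrier n
    shear i w v j = v j + v i * w j

    shearMatrix : Fin n → Vector Carrier n → Matrix n
    shearMatrix i w r c = δ r c + δ r i * w c

    ⊗-shearMatrix : ∀ i w v → v ⊗ shearMatrix i w ≋ shear i w v
    ⊗-shearMatrix i w v j = begin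
      sum (λ r → v r * (δ r j + δ r i * w j))
        ≈⟨ sum-cong-≋ {y = λ r → v r * δ r j + v r * δ r i * w j} (λ r → trans (distribˡ _ _ _) (+-congˡ (sym (*-assoc _ _ _)))) ⟩
      sum (λ r → v r * δ r j + v r * δ r i * w j)
        ≈⟨ ∑-distrib-+ (λ r → v r * δ r j) (λ r → v r * δ r i * w j) ⟩
      sum (λ r → v r * δ r j) + sum (λ r → v r * δ r i * w j)
        ≈⟨ +-cong (sum-δ v j) (trans (sym (*-distribʳ-sum (w j) (λ r → v r * δ r i))) (*-congʳ (sum-δ v i))) ⟩
      v j + v i * w j ∎

    det-shearMatrix : ∀ i w → w i ≈ 0# → det (shearMatrix i w) ≈ 1#
    det-shearMatrix i w wᵢ≈0 = det-unitriangularRow _ i diagonal λ r c r≢i r≢c →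
      trans (+-cong (δ-off-diagonal r≢c) (trans (*-congʳ (δ-off-diagonal r≢i)) (zeroˡ _))) (+-identityˡ 0#)
      where
      diagonal : ∀ r → shearMatrix i w r r ≈ 1#
      diagonal r with r Fin.≟ i
      ... | yes ≡.refl = trans (+-cong (δ-diagonal r) (trans (*-congˡ wᵢ≈0) (zeroʳ _))) (+-identityʳ 1#)
      ... | no r≢i     = trans (+-cong (δ-diagonal r) (trans (*-congʳ (δ-off-diagonal r≢i)) (zeroˡ _))) (+-identityʳ 1#)

    shear-cong : ∀ i w {u v} → u ≋ v → shear i w u ≋ shear i w v
    shear-cong i w u≋v j = +-cong (u≋v j) (*-congʳ (u≋v i))

    shear-∼ : ∀ i w {u v} → u ∼ v → shear i w u ∼ shear i w v
    shear-∼ i w {u} {v} (c , c≉0 , u≋cv) = c , c≉0 , λ j → begin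
      u j + u i * w j              ≈⟨ +-cong (u≋cv j) (*-congʳ (u≋cv i)) ⟩
      c * v j + c * v i * w j      ≈⟨ +-congˡ (*-assoc _ _ _) ⟩
      c * v j + c * (v i * w j)    ≈⟨ distribˡ _ _ _ ⟨
      c * (v j + v i * w j)        ∎

    -- Because wᵢ = 0, the first shear leaves coordinate i unchanged, so the second one adds the
    -- same multiple of w′ and the two changes cancel.
    shear-shear : ∀ i {w w′} v → w i ≈ 0# → (∀ j → w j + w′ j ≈ 0#) → shear i w′ (shear i w v) ≋ v
    shear-shear i {w} {w′} v wᵢ≈0 w+w′≈0 j = begin
      v j + v i * w j + (v i + v i * w i) * w′ j   ≈⟨ +-congˡ (*-congʳ (trans (+-congˡ (trans (*-congˡ wᵢ≈0) (zeroʳ _))) (+-identityʳ _))) ⟩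
      v j + v i * w j + v i * w′ j                 ≈⟨ +-assoc _ _ _ ⟩
      v j + (v i * w j + v i * w′ j)               ≈⟨ +-congˡ (distribˡ _ _ _) ⟨
      v j + v i * (w j + w′ j)                     ≈⟨ +-congˡ (trans (*-congˡ (w+w′≈0 j)) (zeroʳ _)) ⟩
      v j + 0#                                     ≈⟨ +-identityʳ _ ⟩
      v j                                          ∎

    shear-0ᵛ : ∀ i w → shear i w 0ᵛ ≋ 0ᵛ
    shear-0ᵛ i w j = trans (+-identityˡ _) (zeroˡ _)

    nonzero-entry : ∀ {v : Vector Carrier n} → ¬ v ≋ 0ᵛ → ∃ λ i → ¬ v i ≈ 0#
    nonzero-entry {v} v≉0 with any? (λ i → ¬? (v i ≈? 0#))
    ... | yes found = found
    ... | no none   = contradiction (λ i → decidable-stable (v i ≈? 0#) λ vᵢ≉0 → none (i , vᵢ≉0)) v≉0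

    Point : Set
    Point = Setoid.Carrier (Points n)

    open Setoid (Points n) public using () renaming (sym to ∼-sym; trans to ∼-trans)

    ≋⇒∼ : ∀ {u v : Vector Carrier n} → u ≋ v → u ∼ v
    ≋⇒∼ u≋v = 1# , 1≉0 , λ i → trans (u≋v i) (sym (*-identityˡ _))

    shearPoint : ∀ i w → w i ≈ 0# → Point → Point
    shearPoint i w wᵢ≈0 (v , v≉0) = shear i w v , λ sv≈0 → v≉0 λ j → begin
      v j                              ≈⟨ shear-shear i v wᵢ≈0 (λ j → -‿inverseʳ (w j)) j ⟨
      shear i (-_ ∘ w) (shear i w v) j ≈⟨ shear-cong i (-_ ∘ w) sv≈0 j ⟩
      shear i (-_ ∘ w) 0ᵛ j            ≈⟨ shear-0ᵛ i (-_ ∘ w) j ⟩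
      0#                               ∎

    basis : Fin n → Point
    basis i = δ i , λ δᵢ≈0 → 1≉0 (trans (sym (δ-diagonal i)) (δᵢ≈0 i))

    module _ {q : ℕ} (L : Labelling n q) where
      open Inverse L using (to; from; to-cong; strictlyInverseˡ; strictlyInverseʳ)

      shearLabel : ∀ i w → w i ≈ 0# → Fin q → Fin q
      shearLabel i w wᵢ≈0 = to ∘ shearPoint i w wᵢ≈0 ∘ from

      shearLabel-to : ∀ i w wᵢ≈0 P → shearLabel i w wᵢ≈0 (to P) ≡ to (shearPoint i w wᵢ≈0 P)
      shearLabel-to i w wᵢ≈0 P =
        to-cong (shear-∼ i w {proj₁ (from (to P))} {proj₁ P} (strictlyInverseʳ P))

      shearLabel-inverse : ∀ i {w w′} wᵢ≈0 w′ᵢ≈0 → (∀ j → w j + w′ j ≈ 0#) →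
        ∀ x → shearLabel i w′ w′ᵢ≈0 (shearLabel i w wᵢ≈0 x) ≡ x
      shearLabel-inverse i {w} {w′} wᵢ≈0 w′ᵢ≈0 w+w′≈0 x =
        ≡.trans (shearLabel-to i w′ w′ᵢ≈0 P)
          (≡.trans (to-cong {shearPoint i w′ w′ᵢ≈0 P} {from x}
                     (≋⇒∼ (shear-shear i (vector L x) wᵢ≈0 w+w′≈0)))
                   (strictlyInverseˡ x))
        where
        P : Point
        P = shearPoint i w wᵢ≈0 (from x)

      shearPermutation : ∀ i w → w i ≈ 0# → Permutation′ q
      shearPermutation i w wᵢ≈0 = mk↔ₛ′
        (shearLabel i w wᵢ≈0) (shearLabel i (-_ ∘ w) -wᵢ≈0)
        (shearLabel-inverse i -wᵢ≈0 wᵢ≈0 λ j → -‿inverseˡ (w j))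
        (shearLabel-inverse i wᵢ≈0 -wᵢ≈0 λ j → -‿inverseʳ (w j))
        where
        -wᵢ≈0 : - w i ≈ 0#
        -wᵢ≈0 = trans (-‿cong wᵢ≈0) -0#≈0#

      -- The representative chosen for the image point is only a multiple of the sheared vector;
      -- that scalar is the one `Induces` asks for.
      shearPermutation-PSL : ∀ i w wᵢ≈0 → shearPermutation i w wᵢ≈0 ∈ PSL L
      shearPermutation-PSL i w wᵢ≈0 = shearMatrix i w , det-shearMatrix i w wᵢ≈0 , λ x →
        let P = shearPoint i w wᵢ≈0 (from x)
            c , c≉0 , P≋ = ∼-sym {from (to P)} {P} (strictlyInverseʳ P)
        in  c , c≉0 , λ j → trans (⊗-shearMatrix i w (vector L x) j) (P≋ j)

      -- Moving pairs of points by transvections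

      module _ (T : Subgroup (Sym (Fin q))) (PSL⊆T : PSL L ⊆ Subgroup.Member T) where
        -- Writing u and v for the vectors of Q and R, the shear at k by w = (v - u)/uₖ takes u to
        -- v, and wₖ = 0 because u and v agree at k. It fixes every vector whose k-th coordinate is
        -- zero, which later keeps one point in place while the other moves.
        pivot : ∀ k (P Q R : Point) → proj₁ Q k ≈ proj₁ R k → ¬ proj₁ Q k ≈ 0# →
          ∃ λ P′ → Joined T (to P) (to Q) (to P′) (to R) × (proj₁ P k ≈ 0# → proj₁ P′ ≋ proj₁ P)
        pivot k P Q@(u , _) R@(v , _) uₖ≈vₖ uₖ≉0 with reciprocal (u k) uₖ≉0
        ... | c , uₖc≈1 = shearPoint k w wₖ≈0 P ,
          (shearPermutation k w wₖ≈0 , PSL⊆T (shearPermutation-PSL k w wₖ≈0) ,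
           shearLabel-to k w wₖ≈0 P ,
           ≡.trans (shearLabel-to k w wₖ≈0 Q) (to-cong {shearPoint k w wₖ≈0 Q} {R} (≋⇒∼ sheared))) ,
          λ Pₖ≈0 j → trans (+-congˡ (trans (*-congʳ Pₖ≈0) (zeroˡ _))) (+-identityʳ _)
          where
          w : Vector Carrier n
          w j = c * (v j + - u j)

          wₖ≈0 : w k ≈ 0#
          wₖ≈0 = trans (*-congˡ (trans (+-congʳ (sym uₖ≈vₖ)) (-‿inverseʳ _))) (zeroʳ _)

          sheared : shear k w u ≋ v
          sheared j = begin
            u j + u k * (c * (v j + - u j))  ≈⟨ +-congˡ (*-assoc _ _ _) ⟨
            u j + u k * c * (v j + - u j)    ≈⟨ +-congˡ (trans (*-congʳ uₖc≈1) (*-identityˡ _)) ⟩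
            u j + (v j + - u j)              ≈⟨ +-comm _ _ ⟩
            v j + - u j + u j                ≈⟨ +-assoc _ _ _ ⟩
            v j + (- u j + u j)              ≈⟨ +-congˡ (-‿inverseˡ _) ⟩
            v j + 0#                         ≈⟨ +-identityʳ _ ⟩
            v j                              ∎

        -- One or two pivots suffice. If k = m, the vector of Q is cleared outside k, leaving a
        -- multiple of the basis vector. Otherwise it first becomes Qₖeₖ + eₘ by a pivot at k, whose
        -- coordinate 1 at m then allows a pivot at m to eₘ.
        to-basis : ∀ k m (P Q : Point) → ¬ proj₁ Q k ≈ 0# →
          ∃ λ P′ → Joined T (to P) (to Q) (to P′) (to (basis m)) ×
            (proj₁ P k ≈ 0# → proj₁ P m ≈ 0# → proj₁ P′ ≋ proj₁ P)
        to-basis k m P Q Qₖ≉0 with k Fin.≟ m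
        ... | yes ≡.refl =
          let P′ , joined , fixed = pivot k P Q R (sym Rₖ≈Qₖ) Qₖ≉0
          in  P′ , ≡.subst (Joined T _ _ _) (to-cong {R} {basis k} (proj₁ Q k , Qₖ≉0 , λ _ → refl)) joined , λ Pₖ≈0 _ → fixed Pₖ≈0
          where
          Rₖ≈Qₖ : proj₁ Q k * δ k k ≈ proj₁ Q k
          Rₖ≈Qₖ = trans (*-congˡ (δ-diagonal k)) (*-identityʳ _)
          R : Point
          R = proj₁ Q k ∗ δ k , λ R≈0 → Qₖ≉0 (trans (sym Rₖ≈Qₖ) (R≈0 k))
        ... | no k≢m =
          let P′ , joined , fixed = pivot k P Q R (sym Rₖ≈Qₖ) Qₖ≉0
              P″ , joined′ , fixed′ = pivot m P′ R (basis m) (trans Rₘ≈1 (sym (δ-diagonal m))) (λ Rₘ≈0 → 1≉0 (trans (sym Rₘ≈1) Rₘ≈0))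
          in  P″ , Joined-trans T joined joined′ , λ Pₖ≈0 Pₘ≈0 j →
                trans (fixed′ (trans (fixed Pₖ≈0 m) Pₘ≈0) j) (fixed Pₖ≈0 j)
          where
          Rₖ≈Qₖ : proj₁ Q k * δ k k + δ m k ≈ proj₁ Q k
          Rₖ≈Qₖ = trans (+-cong (trans (*-congˡ (δ-diagonal k)) (*-identityʳ _)) (δ-off-diagonal (k≢m ∘ ≡.sym))) (+-identityʳ _)
          Rₘ≈1 : proj₁ Q k * δ k m + δ m m ≈ 1#
          Rₘ≈1 = trans (+-cong (trans (*-congˡ (δ-off-diagonal k≢m)) (zeroʳ _)) (δ-diagonal m)) (+-identityˡ _)
          R : Point
          R = proj₁ Q k ∗ δ k ⊕ δ m , λ R≈0 → Qₖ≉0 (trans (sym Rₖ≈Qₖ) (R≈0 k))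

  -- If all later coordinates vanished, v would equal v₀e₀ with v₀ nonzero. The entry found is the
  -- pivot for a second move that leaves e₀ alone.
  off-axis-entry : ∀ {n} {v : Vector Carrier (suc n)} → ¬ v ≋ 0ᵛ → ¬ v ∼ δ zero → ∃ λ k → ¬ v (suc k) ≈ 0#
  off-axis-entry {n} {v} v≉0 v≁e₀ with any? (λ k → ¬? (v (suc k) ≈? 0#))
  ... | yes found = found
  ... | no none   = contradiction (v zero , v₀≉0 , on-axis) v≁e₀
    where
    tail≈0 : ∀ k → v (suc k) ≈ 0#
    tail≈0 k = decidable-stable (v (suc k) ≈? 0#) λ vₖ≉0 → none (k , vₖ≉0)

    v₀≉0 : ¬ v zero ≈ 0#
    v₀≉0 v₀≈0 = v≉0 λ where
      zero    → v₀≈0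
      (suc k) → tail≈0 k

    on-axis : v ≋ v zero ∗ δ zero
    on-axis zero    = sym (*-identityʳ _)
    on-axis (suc k) = trans (tail≈0 k) (sym (zeroʳ _))

  module _ {n q : ℕ} (L : Labelling (suc (suc n)) q) where
    open Inverse L using (to; from; to-cong; from-cong; strictlyInverseˡ; strictlyInverseʳ)

    e₀ e₁ : Fin q
    e₀ = to (basis zero)
    e₁ = to (basis (suc zero))

    e₀≢e₁ : e₀ ≢ e₁
    e₀≢e₁ eq with ∼-trans {i = basis zero} {j = from e₀} {k = basis (suc zero)} (∼-sym {x = from e₀} {y = basis zero} (strictlyInverseʳ (basis zero)))
                    (∼-trans {i = from e₀} {j = from e₁} {k = basis (suc zero)} (from-cong eq) (strictlyInverseʳ (basis (suc zero))))
    ... | c , _ , e₀≋ce₁ = 1≉0 (trans (e₀≋ce₁ zero) (zeroʳ c))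

    module _ (T : Subgroup (Sym (Fin q))) (PSL⊆T : PSL L ⊆ Subgroup.Member T) where

      -- First i is sent to `e₀`, dragging j to some Q. By injectivity Q is not `e₀`, so it has a
      -- nonzero coordinate past the first, and pivots at coordinates past the first send it to
      -- `e₁`.
      to-axes : ∀ i j → i ≢ j → Joined T i j e₀ e₁
      to-axes i j i≢j =
        let k , iₖ≉0 = nonzero-entry (proj₂ (from i))
            Q , joined@(t , _ , jt , it) , _ = to-basis L T PSL⊆T k zero (from j) (from i) iₖ≉0
            m , Qₘ≉0 = off-axis-entry (proj₂ Q) λ Q∼e₀ → i≢j (≡.trans (≡.sym (strictlyInverseˡ i))
              (≡.trans (≡.sym (·-injective t (≡.trans jt (≡.trans (to-cong {Q} {basis zero} Q∼e₀) (≡.sym it)))))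
                (strictlyInverseˡ j)))
            P , joined′ , fixed = to-basis L T PSL⊆T (suc m) (suc zero) (basis zero) Q Qₘ≉0
        in ≡.subst₂ (λ x y → Joined T x y e₀ e₁) (strictlyInverseˡ i) (strictlyInverseˡ j)
             (Joined-trans T (Joined-swap T joined)
               -- The basis vector for `e₀` is zero at both pivot coordinates `suc m` and
               -- `suc zero`, so its point stays in place.
               (≡.subst (λ x → Joined T e₀ (to Q) x e₁) (to-cong {P} {basis zero} (≋⇒∼ (fixed refl refl))) joined′))

      PSL⊆⇒twoTransitive : TwoTransitive T
      PSL⊆⇒twoTransitive i j k l i≢j k≢l = Joined-trans T (to-axes i j i≢j)
        (Joined-sym T (to-axes k l k≢l))

open import Data.Nat using (_*_)
open ≡ using (refl; sym; trans; cong; subst; subst₂; module ≡-Reasoning)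
open ≡-Reasoning

-- 2-transitivity of the alternating groups

transpose-source : ∀ {n} (i j : Fin n) → Components.transpose i j i ≡ j
transpose-source i j rewrite dec-true (i Fin.≟ i) refl = refl

transpose-fixes : ∀ {n} {i j k : Fin n} → k ≢ i → k ≢ j → Components.transpose i j k ≡ k
transpose-fixes {i = i} {j} {k} k≢i k≢j
  rewrite dec-false (k Fin.≟ i) k≢i | dec-false (k Fin.≟ j) k≢j = refl

-- At most two transpositions carry (i, j) to (k, l). When one is enough, parity is corrected by
-- transposing two points distinct from k and l, which leaves the images unchanged.
alternating⊆⇒twoTransitive : ∀ {n} (T : Subgroup (Sym (Fin n))) →
  (∀ k l → ∃₂ λ (a b : Fin n) → a ≢ b × (k ≢ a × k ≢ b) × (l ≢ a × l ≢ b)) →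
  Alternating n ⊆ Subgroup.Member T → TwoTransitive T
alternating⊆⇒twoTransitive {n} T avoiding A⊆T i j k l i≢j k≢l
  with avoiding k l
... | a , b , a≢b , (k≢a , k≢b) , (l≢a , l≢b) = result
  where
  even : (ts : TranspositionList n) → All (λ (x , y) → x ≢ y) ts → 2 ∣ length ts →
         i · eval ts ≡ k → j · eval ts ≡ l →
         Joined T i j k l
  even ts distinct 2∣ i↦k j↦l = eval ts , A⊆T (ts , distinct , 2∣ , λ _ → refl) , i↦k , j↦l

  result : Joined T i j k l
  result with i Fin.≟ k
  result | yes refl with j Fin.≟ l
  ... | yes refl = even [] [] (divides 0 refl) refl refl
  ... | no j≢l = even ((j , l) ∷ (a , b) ∷ []) (j≢l ∷ a≢b ∷ []) (divides 1 refl)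
    (trans (cong (Components.transpose a b) (transpose-fixes i≢j k≢l)) (transpose-fixes k≢a k≢b))
    (trans (cong (Components.transpose a b) (transpose-source j l)) (transpose-fixes l≢a l≢b))
  result | no i≢k with Components.transpose i k j Fin.≟ l
  ... | yes j↦l = even ((i , k) ∷ (a , b) ∷ []) (i≢k ∷ a≢b ∷ []) (divides 1 refl)
    (trans (cong (Components.transpose a b) (transpose-source i k)) (transpose-fixes k≢a k≢b))
    (trans (cong (Components.transpose a b) j↦l) (transpose-fixes l≢a l≢b))
  -- After (i k) has moved j to j′, the transposition (j′ l) fixes k, since k is the image of i and
  -- differs from both j′ and l.
  ... | no j′≢l = even ((i , k) ∷ (Components.transpose i k j , l) ∷ []) (i≢k ∷ j′≢l ∷ []) (divides 1 refl)
    (trans (cong (Components.transpose (Components.transpose i k j) l) (transpose-source i k)) (transpose-fixes k≢j′ k≢l))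
    (transpose-source (Components.transpose i k j) l)
    where
    k≢j′ : k ≢ Components.transpose i k j
    k≢j′ eq = i≢j (·-injective (Perm.transpose i k) (trans (transpose-source i k) eq))

avoiding₆ : ∀ (k l : Fin 6) → ∃₂ λ (a b : Fin 6) → a ≢ b × (k ≢ a × k ≢ b) × (l ≢ a × l ≢ b)
avoiding₆ = from-yes (all? {n = 6} λ k → all? {n = 6} λ l → any? {n = 6} λ a → any? {n = 6} λ b →
  ¬? (a Fin.≟ b) ×-dec (¬? (k Fin.≟ a) ×-dec ¬? (k Fin.≟ b)) ×-dec (¬? (l Fin.≟ a) ×-dec ¬? (l Fin.≟ b)))

-- Hamming graphs and codes

vec-ext : ∀ {A : Set} {n} {u v : Vec A n} → (∀ c → lookup u c ≡ lookup v c) → u ≡ v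
vec-ext {u = u} {v} p = trans (sym (tabulate∘lookup u)) (trans (tabulate-cong p) (tabulate∘lookup v))

-- Adjacency for entry functions. The index type is left free so that coordinates can also be pairs
-- of a block and a position.
DifferOnce : {P A : Set} → (P → A) → (P → A) → Set
DifferOnce f g = ∃ λ c → f c ≢ g c × (∀ e → e ≢ c → f e ≡ g e)

d≡0⇒≡ : ∀ {m q} (u v : Vertex m q) → d u v ≡ 0 → u ≡ v
d≡0⇒≡ []      []      _ = refl
d≡0⇒≡ (x ∷ u) (y ∷ v) p with x Fin.≟ y
... | yes refl = cong (x ∷_) (d≡0⇒≡ u v p)
d≡0⇒≡ (x ∷ u) (y ∷ v) () | no _

d≡1⇒differOnce : ∀ {m q} (u v : Vertex m q) → d u v ≡ 1 → DifferOnce (lookup u) (lookup v)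
d≡1⇒differOnce []      []      ()
d≡1⇒differOnce (x ∷ u) (y ∷ v) p with x Fin.≟ y
... | no x≢y = zero , x≢y , λ where
  zero    0≢0 → contradiction refl 0≢0
  (suc e) _   → cong (λ w → lookup w e) (d≡0⇒≡ u v (suc-injective p))
... | yes refl with d≡1⇒differOnce u v p
...   | c , c-differs , others = suc c , c-differs , λ where
  zero    _ → refl
  (suc e) e≢c → others e (e≢c ∘ cong suc)

differOnce⇒d≡1 : ∀ {m q} (u v : Vertex m q) → DifferOnce (lookup u) (lookup v) → d u v ≡ 1
differOnce⇒d≡1 []      []      (() , _)
differOnce⇒d≡1 (x ∷ u) (y ∷ v) (c , c-differs , others) with x Fin.≟ y | c
... | yes x≡y | zero   = contradiction x≡y c-differs
... | yes _   | suc c′ = differOnce⇒d≡1 u v (c′ , c-differs , λ e e≢c → others (suc e) λ where refl → e≢c refl)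
... | no  _   | zero   = cong suc (trans (cong (d u) (sym u≡v)) (d-refl u))
  where
  u≡v : u ≡ v
  u≡v = vec-ext λ e → others (suc e) λ ()
... | no x≢y  | suc _  = contradiction (others zero λ ()) x≢y

-- Distance zero means equality, so being at distance at least 1 from every codeword amounts to not
-- being a codeword.
Neighbours⇔ : ∀ {m q} (C : Code m q) ν → Neighbours C ν ⇔ (¬ C ν × ∃ λ β → C β × d ν β ≡ 1)
Neighbours⇔ C ν = mk⇔
  (λ (near , far) → (λ ν∈C → n≮0 (subst (1 ℕ.≤_) (d-refl ν) (far ν ν∈C))) , near)
  (λ (ν∉C , near) → near , λ β β∈C → n≢0⇒n>0 λ p → ν∉C (subst C (sym (d≡0⇒≡ ν β p)) β∈C))

-- The full automorphism group of the code is the group that will witness neighbour transitivity;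
-- transitivity then only requires exhibiting suitable automorphisms.
codeAutomorphisms : ∀ {m q} → Code m q → Subgroup (Sym (Vertex m q))
codeAutomorphisms {m} {q} C = record
  { Member    = IsCodeAutomorphism C
  ; resp      = λ f≈g (adj , code) →
      (λ u v → subst₂ (λ x y → d u v ≡ 1 ⇔ d x y ≡ 1) (f≈g u) (f≈g v) (adj u v)) ,
      (λ v → subst (λ x → C v ⇔ C x) (f≈g v) (code v))
  ; ε-closed  = (λ _ _ → mk⇔ id id) , (λ _ → mk⇔ id id)
  ; ∙-closed  = λ (adj₁ , code₁) (adj₂ , code₂) →
      (λ u v → mk⇔ (to (adj₂ _ _) ∘ to (adj₁ u v)) (from (adj₁ u v) ∘ from (adj₂ _ _))) ,
      (λ v → mk⇔ (to (code₂ _) ∘ to (code₁ v)) (from (code₁ v) ∘ from (code₂ _)))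
  ; ⁻¹-closed = λ {f} (adj , code) →
      (λ u v → let open Inverse f using () renaming (from to f⁻¹; strictlyInverseˡ to eq) in mk⇔
        (λ p → from (adj (f⁻¹ u) (f⁻¹ v)) (subst₂ (λ x y → d x y ≡ 1) (sym (eq u)) (sym (eq v)) p))
        (λ p → subst₂ (λ x y → d x y ≡ 1) (eq u) (eq v) (to (adj (f⁻¹ u) (f⁻¹ v)) p))) ,
      (λ v → let open Inverse f using () renaming (from to f⁻¹; strictlyInverseˡ to eq) in mk⇔
        (λ p → from (code (f⁻¹ v)) (subst C (sym (eq v)) p))
        (λ p → subst C (eq v) (to (code (f⁻¹ v)) p)))
  }
  where open Equivalence

automorphism-Neighbours : ∀ {m q} {C : Code m q} {f} → IsCodeAutomorphism C f →
  ∀ {ν} → Neighbours C ν → Neighbours C (ν · f)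
automorphism-Neighbours {C = C} {f} (adj , code) {ν} ν∈C₁ =
  let ν∉C , β , β∈C , near = to (Neighbours⇔ C ν) ν∈C₁
  in  from (Neighbours⇔ C (ν · f))
        (ν∉C ∘ from (code ν) , β · f , to (code β) β∈C , to (adj ν β) near)
  where open Equivalence

-- Vertices of H(kq, q), with the coordinates arranged as k blocks of length q

module _ {k q : ℕ} where

  entry : Vertex (k * q) q → Fin k × Fin q → Fin q
  entry v (i , j) = lookup v (combine i j)

  fromEntries : (Fin k × Fin q → Fin q) → Vertex (k * q) q
  fromEntries e = tabulate (e ∘ remQuot q)

  entry∘fromEntries : ∀ e p → entry (fromEntries e) p ≡ e p
  entry∘fromEntries e (i , j) =
    trans (lookup∘tabulate _ (combine i j)) (cong e (remQuot-combine i j))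

  lookup≡entry : ∀ v c → lookup v c ≡ entry v (remQuot q c)
  lookup≡entry v c = cong (lookup v) (sym (combine-remQuot {k} q c))

  entry-ext : ∀ {u v} → (∀ p → entry u p ≡ entry v p) → u ≡ v
  entry-ext {u} {v} p = vec-ext λ c →
    trans (lookup≡entry u c) (trans (p (remQuot q c)) (sym (lookup≡entry v c)))

  adjacent⇔ : ∀ u v → d u v ≡ 1 ⇔ DifferOnce (entry u) (entry v)
  adjacent⇔ u v = mk⇔
    (λ p → let c , c-differs , others = d≡1⇒differOnce u v p in
      remQuot q c ,
      (λ eq → c-differs (trans (lookup≡entry u c) (trans eq (sym (lookup≡entry v c))))) ,
      λ e e≢c → others _ λ eq → e≢c (trans (sym (remQuot-combine _ _)) (cong (remQuot q) eq)))
    (λ (c , c-differs , others) → differOnce⇒d≡1 u v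
      (uncurry combine c , c-differs , λ e e≢c →
        trans (lookup≡entry u e) (trans
          (others _ λ eq → e≢c (trans (sym (combine-remQuot {k} q e)) (cong (uncurry combine) eq)))
          (sym (lookup≡entry v e)))))

  module _ (σ : (Fin k × Fin q) ↔ (Fin k × Fin q)) (π : Fin k → Permutation′ q) where

    private
      act act⁻¹ : Vertex (k * q) q → Fin k × Fin q → Fin q
      act   v p = entry v (p · σ) · π (proj₁ p)
      act⁻¹ v p = let r = p · ↔-sym σ in entry v r · ↔-sym (π (proj₁ r))

    -- Coordinates are permuted by pullback: the new entry at `p` is read at `p · σ`, then
    -- relabelled by a permutation depending only on the block of `p`. Hence coordinate permutations
    -- will multiply a codeword on the left and letter permutations on the right.
    monomial : Vertex (k * q) q ↔ Vertex (k * q) q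
    monomial = mk↔ₛ′ (fromEntries ∘ act) (fromEntries ∘ act⁻¹)
      (λ v → entry-ext λ p → begin
        entry (fromEntries (act (fromEntries (act⁻¹ v)))) p          ≡⟨ entry∘fromEntries (act (fromEntries (act⁻¹ v))) p ⟩
        entry (fromEntries (act⁻¹ v)) (p · σ) · π (proj₁ p)          ≡⟨ cong (_· π (proj₁ p)) (entry∘fromEntries (act⁻¹ v) (p · σ)) ⟩
        act⁻¹ v (p · σ) · π (proj₁ p)
          ≡⟨ cong (λ x → entry v x · ↔-sym (π (proj₁ x)) · π (proj₁ p)) (Inverse.strictlyInverseʳ σ p) ⟩
        entry v p · ↔-sym (π (proj₁ p)) · π (proj₁ p)                ≡⟨ Inverse.strictlyInverseˡ (π (proj₁ p)) _ ⟩
        entry v p                                                    ∎)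
      (λ v → entry-ext λ p → let r = p · ↔-sym σ in begin
        entry (fromEntries (act⁻¹ (fromEntries (act v)))) p          ≡⟨ entry∘fromEntries (act⁻¹ (fromEntries (act v))) p ⟩
        entry (fromEntries (act v)) r · ↔-sym (π (proj₁ r))          ≡⟨ cong (_· ↔-sym (π (proj₁ r))) (entry∘fromEntries (act v) r) ⟩
        entry v (r · σ) · π (proj₁ r) · ↔-sym (π (proj₁ r))          ≡⟨ Inverse.strictlyInverseʳ (π (proj₁ r)) _ ⟩
        entry v (r · σ)                                              ≡⟨ cong (entry v) (Inverse.strictlyInverseˡ σ p) ⟩
        entry v p                                                    ∎)

    entry-monomial : ∀ v p → entry (v · monomial) p ≡ entry v (p · σ) · π (proj₁ p)
    entry-monomial v = entry∘fromEntries (act v)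

    monomial-isGraphAutomorphism : IsGraphAutomorphism (H (k * q) q) monomial
    monomial-isGraphAutomorphism u v = mk⇔
      (from (adjacent⇔ (u · monomial) (v · monomial)) ∘ forward ∘ to (adjacent⇔ u v))
      (from (adjacent⇔ u v) ∘ backward ∘ to (adjacent⇔ (u · monomial) (v · monomial)))
      where
      open Equivalence
      forward : DifferOnce (entry u) (entry v) →
                DifferOnce (entry (u · monomial)) (entry (v · monomial))
      forward (c , c-differs , others) = c · ↔-sym σ ,
        (λ eq → c-differs (subst (λ x → entry u x ≡ entry v x) (Inverse.strictlyInverseˡ σ c)
          (·-injective (π _) (trans (sym (entry-monomial u _)) (trans eq (entry-monomial v _)))))) ,
        λ e e≢c → trans (entry-monomial u e) (trans
          (cong (_· π (proj₁ e)) (others (e · σ) λ eq →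
            e≢c (trans (sym (Inverse.strictlyInverseʳ σ e)) (cong (_· ↔-sym σ) eq))))
          (sym (entry-monomial v e)))
      backward : DifferOnce (entry (u · monomial)) (entry (v · monomial)) →
                 DifferOnce (entry u) (entry v)
      backward (c , c-differs , others) = c · σ ,
        (λ eq → c-differs (trans (entry-monomial u c)
          (trans (cong (_· π (proj₁ c)) eq) (sym (entry-monomial v c))))) ,
        λ e e≢c → subst (λ x → entry u x ≡ entry v x) (Inverse.strictlyInverseˡ σ e)
          (·-injective (π _) (trans (sym (entry-monomial u _)) (trans
            (others (e · ↔-sym σ) λ eq →
              e≢c (trans (sym (Inverse.strictlyInverseˡ σ e)) (cong (_· σ) eq)))
            (entry-monomial v _))))

-- Codes built from several homomorphisms, and their translations

blockwise : {I A : Set} → (I → A ↔ A) → (I × A) ↔ (I × A)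
blockwise σ = mk↔ₛ′
  (λ (i , j) → i , j · σ i)
  (λ (i , j) → i , j · ↔-sym (σ i))
  (λ (i , j) → cong (i ,_) (Inverse.strictlyInverseˡ (σ i) j))
  (λ (i , j) → cong (i ,_) (Inverse.strictlyInverseʳ (σ i) j))

module _ {k q : ℕ} (T : Subgroup (Sym (Fin q)))
         (ρs : Vec (Subgroup.Element T → Permutation′ q) k) where
  open Group (Subgroup.group T) using (Carrier; _∙_; _⁻¹; ε; rawGroup)

  word : Carrier → Vertex (k * q) q
  word t = concat (Vec.map (α t) ρs)

  entry-word : ∀ t ((i , j) : Fin k × Fin q) → entry (word t) (i , j) ≡ j · lookup ρs i t
  entry-word t (i , j) = begin
    lookup (word t) (combine i j)             ≡⟨ lookup-concat (Vec.map (α t) ρs) i j ⟩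
    lookup (lookup (Vec.map (α t) ρs) i) j    ≡⟨ cong (λ w → lookup w j) (lookup-map i (α t) ρs) ⟩
    lookup (α t (lookup ρs i)) j              ≡⟨ lookup∘tabulate _ j ⟩
    j · lookup ρs i t                         ∎

  ≡word : ∀ {v} t → (∀ ((i , j) : Fin k × Fin q) → entry v (i , j) ≡ j · lookup ρs i t) → v ≡ word t
  ≡word t p = entry-ext λ c → trans (p c) (sym (entry-word t c))

  module _ (homs : ∀ i → IsGroupHomomorphism rawGroup (Group.rawGroup (Sym (Fin q))) (lookup ρs i)) where

    private
      ρ : Fin k → Carrier → Permutation′ q
      ρ = lookup ρs

      ρ-∙ : ∀ i s t j → j · ρ i (s ∙ t) ≡ j · ρ i s · ρ i t
      ρ-∙ i s t j = IsGroupHomomorphism.homo (homs i) s t j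

      ρ-⁻¹ : ∀ i s j → j · ρ i (s ⁻¹) ≡ j · ↔-sym (ρ i s)
      ρ-⁻¹ i s j = IsGroupHomomorphism.⁻¹-homo (homs i) s j

    translation : Carrier → Carrier → Vertex (k * q) q ↔ Vertex (k * q) q
    translation s t = monomial (blockwise λ i → ρ i s) (λ i → ρ i t)

    entry-translation : ∀ s t v i j →
      entry (v · translation s t) (i , j) ≡ entry v (i , j · ρ i s) · ρ i t
    entry-translation s t v i j = entry-monomial (blockwise λ i → ρ i s) (λ i → ρ i t) v (i , j)

    word-translation : ∀ s t g → word g · translation s t ≡ word (s ∙ g ∙ t)
    word-translation s t g = ≡word _ λ (i , j) → begin
      entry (word g · translation s t) (i , j)   ≡⟨ entry-translation s t (word g) i j ⟩
      entry (word g) (i , j · ρ i s) · ρ i t     ≡⟨ cong (_· ρ i t) (entry-word g (i , j · ρ i s)) ⟩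
      j · ρ i s · ρ i g · ρ i t                  ≡⟨ cong (_· ρ i t) (ρ-∙ i s g j) ⟨
      j · ρ i (s ∙ g) · ρ i t                    ≡⟨ ρ-∙ i (s ∙ g) t j ⟨
      j · ρ i (s ∙ g ∙ t)                        ∎

    translation-isCodeAutomorphism : ∀ s t → IsCodeAutomorphism C⟨ T , ρs ⟩ (translation s t)
    translation-isCodeAutomorphism s t =
      monomial-isGraphAutomorphism (blockwise λ i → ρ i s) (λ i → ρ i t) , λ v → mk⇔
        (λ (g , v≡g) → s ∙ g ∙ t , trans (cong (_· translation s t) v≡g) (word-translation s t g))
        -- Conversely, a vertex sent to the word of h is the word of s⁻¹ht⁻¹. Entries are compared
        -- after applying the injective `ρ i t`, at the position r that `ρ i s` carries to j.
        (λ (h , eq) → s ⁻¹ ∙ h ∙ t ⁻¹ , ≡word _ λ (i , j) →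
          ·-injective (ρ i t) (let r = j · ↔-sym (ρ i s) in begin
            entry v (i , j) · ρ i t                    ≡⟨ cong (λ x → entry v (i , x) · ρ i t) (Inverse.strictlyInverseˡ (ρ i s) j) ⟨
            entry v (i , r · ρ i s) · ρ i t            ≡⟨ entry-translation s t v i r ⟨
            entry (v · translation s t) (i , r)        ≡⟨ cong (λ w → entry w (i , r)) eq ⟩
            entry (word h) (i , r)                     ≡⟨ entry-word h (i , r) ⟩
            r · ρ i h                                  ≡⟨ cong (_· ρ i h) (ρ-⁻¹ i s j) ⟨
            j · ρ i (s ⁻¹) · ρ i h                     ≡⟨ ρ-∙ i (s ⁻¹) h j ⟨
            j · ρ i (s ⁻¹ ∙ h)                         ≡⟨ Inverse.strictlyInverseˡ (ρ i t) _ ⟨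
            j · ρ i (s ⁻¹ ∙ h) · ↔-sym (ρ i t) · ρ i t ≡⟨ cong (_· ρ i t) (ρ-⁻¹ i t _) ⟨
            j · ρ i (s ⁻¹ ∙ h) · ρ i (t ⁻¹) · ρ i t    ≡⟨ cong (_· ρ i t) (ρ-∙ i (s ⁻¹ ∙ h) (t ⁻¹) j) ⟨
            j · ρ i (s ⁻¹ ∙ h ∙ t ⁻¹) · ρ i t          ∎))

-- The code of an automorphism with square 1, and the interchange of its halves

module _ {q : ℕ} (T : Subgroup (Sym (Fin q)))
         (τ : Subgroup.Element T → Subgroup.Element T)
         (τ-aut : IsAutomorphism T τ) (τ²≈id : SquaresToIdentity T τ) where
  open Group (Subgroup.group T) using (Carrier; _∙_; _⁻¹; ε; rawGroup)
  open IsGroupIsomorphism τ-aut using (isGroupHomomorphism)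

  private
    ρs : Vec (Carrier → Permutation′ q) 2
    ρs = proj₁ ∷ (proj₁ ∘ τ) ∷ []

    C : Code (2 * q) q
    C = C⟨ T , ρs ⟩

    homs : ∀ i → IsGroupHomomorphism rawGroup (Group.rawGroup (Sym (Fin q))) (lookup ρs i)
    homs zero = record
      { isMonoidHomomorphism = record
        { isMagmaHomomorphism = record
          { isRelHomomorphism = record { cong = id } ; homo = λ _ _ _ → refl }
        ; ε-homo = λ _ → refl
        }
      ; ⁻¹-homo = λ _ _ → refl
      }
    homs (suc zero) = record
      { isMonoidHomomorphism = record
        { isMagmaHomomorphism = record
          { isRelHomomorphism = record { cong = λ {x} {y} → ⟦⟧-cong {x} {y} } ; homo = homo }
        ; ε-homo = ε-homo
        }
      ; ⁻¹-homo = ⁻¹-homo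
      }
      where open IsGroupHomomorphism isGroupHomomorphism

    interchange : (Fin 2 × Fin q) ↔ (Fin 2 × Fin q)
    interchange = mk↔ₛ′
      (λ (i , j) → opposite i , j) (λ (i , j) → opposite i , j)
      (λ (i , j) → cong (_, j) (opposite-involutive i))
      (λ (i , j) → cong (_, j) (opposite-involutive i))

  swap : Vertex (2 * q) q ↔ Vertex (2 * q) q
  swap = monomial interchange (λ _ → ↔-id (Fin q))

  entry-swap : ∀ v i j → entry {2} (v · swap) (i , j) ≡ entry {2} v (opposite i , j)
  entry-swap v i j = entry-monomial interchange (λ _ → ↔-id (Fin q)) v (i , j)

  swap-swap : ∀ v → v · swap · swap ≡ v
  swap-swap v = entry-ext {2} λ (i , j) → begin
    entry {2} (v · swap · swap) (i , j)            ≡⟨ entry-swap (v · swap) i j ⟩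
    entry {2} (v · swap) (opposite i , j)          ≡⟨ entry-swap v (opposite i) j ⟩
    entry {2} v (opposite (opposite i) , j)        ≡⟨ cong (λ x → entry {2} v (x , j)) (opposite-involutive i) ⟩
    entry {2} v (i , j)                            ∎

  -- The swapped word has halves τ(t) and t; the latter is the second half of the word of τ(t)
  -- because τ² = 1.
  word-swap : ∀ t → word T ρs t · swap ≡ word T ρs (τ t)
  word-swap t = ≡word T ρs (τ t) λ where
    (zero , j)     → trans (entry-swap (word T ρs t) zero j) (entry-word T ρs t (suc zero , j))
    (suc zero , j) → trans (entry-swap (word T ρs t) (suc zero) j)
                       (trans (entry-word T ρs t (zero , j)) (sym (τ²≈id t j)))

  swap-isCodeAutomorphism : IsCodeAutomorphism C swap
  swap-isCodeAutomorphism = monomial-isGraphAutomorphism interchange (λ _ → ↔-id (Fin q)) ,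
    -- As `swap` is an involution, the converse is the forward direction applied to `v · swap`.
    λ v → mk⇔ forward λ p → subst C (swap-swap v) (forward p)
    where
    forward : ∀ {v} → C v → C (v · swap)
    forward (t , v≡t) = τ t , trans (cong (_· swap) v≡t) (word-swap t)

  -- Codewords and neighbours as single orbits

  module _ (2-transitive : TwoTransitive T) {a b : Fin q} (a≢b : a ≢ b) where

    private
      _≟_ : (x y : Fin 2 × Fin q) → Dec (x ≡ y)
      _≟_ = ≡-dec Fin._≟_ Fin._≟_

      -- The codeword of 1 has entry j at position j of each half; here its entry at position a of
      -- the first half is changed to b.
      baseEntry : Fin 2 × Fin q → Fin q
      baseEntry c with c ≟ (zero , a)
      ... | yes _ = b
      ... | no  _ = proj₂ c

      base : Vertex (2 * q) q
      base = fromEntries {2} baseEntry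

      base-at : entry {2} base (zero , a) ≡ b
      base-at with e ← entry∘fromEntries {2} baseEntry (zero , a)
        with (zero , a) ≟ (zero , a)
      ... | yes _  = e
      ... | no a≢a = contradiction refl a≢a

      base-off : ∀ c → c ≢ (zero , a) → entry {2} base c ≡ proj₂ c
      base-off c c≢a with e ← entry∘fromEntries {2} baseEntry c
        with c ≟ (zero , a)
      ... | yes c≡a = contradiction c≡a c≢a
      ... | no _    = e

      entry-wordε : ∀ c → entry {2} (word T ρs ε) c ≡ proj₂ c
      entry-wordε (i , j) = trans (entry-word T ρs ε (i , j)) (IsGroupHomomorphism.ε-homo (homs i) j)

    base-Neighbours : Neighbours C base
    base-Neighbours = Equivalence.from (Neighbours⇔ C base)
      (base∉C , word T ρs ε , (ε , refl) , Equivalence.from (adjacent⇔ {2} base (word T ρs ε))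
        ((zero , a) ,
         (λ eq → a≢b (sym (trans (sym base-at) (trans eq (entry-wordε (zero , a)))))) ,
         (λ c c≢a → trans (base-off c c≢a) (sym (entry-wordε c)))))
      where
      base∉C : ¬ C base
      -- A codeword equal to `base` would come from a permutation taking both a and b to b.
      base∉C (t , eq) = a≢b (·-injective (proj₁ t) (trans
        (trans (sym (entry-word T ρs t (zero , a))) (trans (cong (λ w → entry {2} w (zero , a)) (sym eq)) base-at))
        (sym (trans (sym (entry-word T ρs t (zero , b)))
          (trans (cong (λ w → entry {2} w (zero , b)) (sym eq)) (base-off (zero , b) λ where refl → a≢b refl))))))

    -- Take s in T with (a, b) · s = (j · t, ν_(1,j)), where j is the entry at
    -- which ν differs from the codeword of t; this translation then sends the
    -- base point to ν.
    base-to-first : ∀ ν t j → entry {2} ν (zero , j) ≢ j · proj₁ t →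
      (∀ c → c ≢ (zero , j) → entry {2} ν c ≡ entry {2} (word T ρs t) c) →
      ∃ λ f → f ∈ IsCodeAutomorphism C × base · f ≡ ν
    base-to-first ν t j differs others
      with 2-transitive a b (j · proj₁ t) (entry {2} ν (zero , j)) a≢b (differs ∘ sym)
    ... | s₀ , s∈T , a·s , b·s =
      translation T ρs homs (t ∙ s ⁻¹) s , translation-isCodeAutomorphism T ρs homs (t ∙ s ⁻¹) s ,
      entry-ext {2} λ c → trans (entry-translation T ρs homs (t ∙ s ⁻¹) s base (proj₁ c) (proj₂ c)) (at c (c ≟ (zero , j)))
      where
      s : Carrier
      s = s₀ , s∈T
      ρ : Fin 2 → Carrier → Permutation′ q
      ρ = lookup ρs
      j↦a : j · proj₁ (t ∙ s ⁻¹) ≡ a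
      j↦a = trans (cong (_· ↔-sym s₀) (sym a·s)) (Inverse.strictlyInverseʳ s₀ a)
      at : ∀ c → Dec (c ≡ (zero , j)) →
           entry {2} base (proj₁ c , proj₂ c · ρ (proj₁ c) (t ∙ s ⁻¹)) · ρ (proj₁ c) s ≡ entry {2} ν c
      at c       (yes refl) = trans (cong (_· s₀) (trans (cong (λ x → entry {2} base (zero , x)) j↦a) base-at)) b·s
      -- Elsewhere `base` agrees with the codeword of 1, whose image under this translation is the
      -- codeword of ts⁻¹s, that is, of t.
      at (i , l) (no c≢j)   = begin
        entry {2} base (i , l · ρ i (t ∙ s ⁻¹)) · ρ i s  ≡⟨ cong (_· ρ i s) (base-off _ moved) ⟩
        l · ρ i (t ∙ s ⁻¹) · ρ i s                       ≡⟨ cong (_· ρ i s) (IsGroupHomomorphism.homo (homs i) t (s ⁻¹) l) ⟩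
        l · ρ i t · ρ i (s ⁻¹) · ρ i s                   ≡⟨ cong (_· ρ i s) (IsGroupHomomorphism.⁻¹-homo (homs i) s _) ⟩
        l · ρ i t · ↔-sym (ρ i s) · ρ i s                ≡⟨ Inverse.strictlyInverseˡ (ρ i s) _ ⟩
        l · ρ i t                                        ≡⟨ entry-word T ρs t (i , l) ⟨
        entry {2} (word T ρs t) (i , l)                  ≡⟨ others (i , l) c≢j ⟨
        entry {2} ν (i , l)                              ∎
        where
        moved : (i , l · ρ i (t ∙ s ⁻¹)) ≢ (zero , a)
        moved eq = c≢j (·-injective (blockwise λ i → ρ i (t ∙ s ⁻¹)) (trans eq (cong (zero ,_) (sym j↦a))))

    -- A difference in the second half is brought to the first half by `swap`, which replaces the
    -- nearby codeword of t by that of τ(t); composing with `swap` again returns to ν.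
    base-to : ∀ ν t → DifferOnce (entry {2} ν) (entry {2} (word T ρs t)) →
      ∃ λ f → f ∈ IsCodeAutomorphism C × base · f ≡ ν
    base-to ν t ((zero , j) , differs , others) =
      base-to-first ν t j (λ eq → differs (trans eq (sym (entry-word T ρs t (zero , j))))) others
    base-to ν t ((suc zero , j) , differs , others) =
      let f , f∈ , eq = base-to-first (ν · swap) (τ t) j differs′ others′
      in  Group._∙_ (Sym (Vertex (2 * q) q)) f swap ,
          Subgroup.∙-closed (codeAutomorphisms C) {f} {swap} f∈ swap-isCodeAutomorphism ,
          trans (cong (_· swap) eq) (swap-swap ν)
      where
      differs′ : entry {2} (ν · swap) (zero , j) ≢ j · proj₁ (τ t)
      differs′ eq = differs (trans (sym (entry-swap ν zero j)) (trans eq (sym (entry-word T ρs t (suc zero , j)))))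

      others′ : ∀ c → c ≢ (zero , j) → entry {2} (ν · swap) c ≡ entry {2} (word T ρs (τ t)) c
      others′ (i , l) c≢j = begin
        entry {2} (ν · swap) (i , l)             ≡⟨ entry-swap ν i l ⟩
        entry {2} ν (opposite i , l)             ≡⟨ others (opposite i , l) (c≢j ∘ ·-injective interchange) ⟩
        entry {2} (word T ρs t) (opposite i , l) ≡⟨ entry-swap (word T ρs t) i l ⟨
        entry {2} (word T ρs t · swap) (i , l)   ≡⟨ cong (λ w → entry {2} w (i , l)) (word-swap t) ⟩
        entry {2} (word T ρs (τ t)) (i , l)      ∎

    neighbourTransitive : NeighbourTransitive C
    neighbourTransitive = codeAutomorphisms C , id ,
      (word T ρs ε , λ v → mk⇔
        -- Right multiplication by t reaches the codeword of t from that of 1. Entries are compared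
        -- because `ε ∙ ε ∙ t` and t agree only in the equality of the group.
        (λ (t , v≡t) → translation T ρs homs ε t , translation-isCodeAutomorphism T ρs homs ε t ,
          trans (entry-ext {2} λ (i , j) → begin
            entry {2} (word T ρs ε · translation T ρs homs ε t) (i , j)
              ≡⟨ entry-translation T ρs homs ε t (word T ρs ε) i j ⟩
            entry {2} (word T ρs ε) (i , j · lookup ρs i ε) · lookup ρs i t
              ≡⟨ cong (_· lookup ρs i t) (entry-wordε (i , _)) ⟩
            j · lookup ρs i ε · lookup ρs i t  ≡⟨ cong (_· lookup ρs i t) (IsGroupHomomorphism.ε-homo (homs i) j) ⟩
            j · lookup ρs i t                  ≡⟨ entry-word T ρs t (i , j) ⟨
            entry {2} (word T ρs t) (i , j)    ∎)
          (sym v≡t))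
        (λ (f , f∈ , eq) → subst C eq (Equivalence.to (proj₂ f∈ _) (ε , refl)))) ,
      (base , λ ν → mk⇔
        (λ ν∈C₁ → let _ , β , (t , β≡t) , near = Equivalence.to (Neighbours⇔ C ν) ν∈C₁ in
          base-to ν t (Equivalence.to (adjacent⇔ {2} ν _) (subst (λ w → d ν w ≡ 1) β≡t near)))
        (λ (f , f∈ , eq) → subst (Neighbours C) eq (automorphism-Neighbours {f = f} f∈ base-Neighbours)))

-- The listed groups

Listed⇒twoTransitive : ∀ {q T} → Listed q T → TwoTransitive T
Listed⇒twoTransitive (is-S₆ {T} all∈T) = alternating⊆⇒twoTransitive T avoiding₆ λ {π} _ → all∈T π
Listed⇒twoTransitive (is-A₆ {T} T⇔A) =
  alternating⊆⇒twoTransitive T avoiding₆ λ {π} → Equivalence.from (T⇔A π)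
Listed⇒twoTransitive (is-PSL[2,11] 2-transitive _ _ _) = 2-transitive
Listed⇒twoTransitive (is-M₁₂ 2-transitive _ _) = 2-transitive
Listed⇒twoTransitive (is-A₇ 2-transitive _) = 2-transitive
Listed⇒twoTransitive (is-HS 2-transitive _ _ _) = 2-transitive
-- Matching on n > 2 exposes n as a double successor, so the first two basis vectors are available.
Listed⇒twoTransitive (is-projective {T = T} (s≤s (s≤s _)) _ _ F L PSL⊆T _) =
  Transvections.PSL⊆⇒twoTransitive F L T λ {π} → PSL⊆T {π}

-- Supplies the letters a and b from which the base neighbour is made; for the projective groups
-- these are the first two basis points.
Listed⇒distinctPoints : ∀ {q T} → Listed q T → ∃₂ λ (a b : Fin q) → a ≢ b
Listed⇒distinctPoints (is-S₆ _) = zero , suc zero , λ ()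
Listed⇒distinctPoints (is-A₆ _) = zero , suc zero , λ ()
Listed⇒distinctPoints (is-PSL[2,11] _ _ _ _) = zero , suc zero , λ ()
Listed⇒distinctPoints (is-M₁₂ _ _ _) = zero , suc zero , λ ()
Listed⇒distinctPoints (is-A₇ _ _) = zero , suc zero , λ ()
Listed⇒distinctPoints (is-HS _ _ _ _) = zero , suc zero , λ ()
Listed⇒distinctPoints (is-projective (s≤s (s≤s _)) _ _ F L _ _) = _ , _ , Transvections.e₀≢e₁ F L

theorem4p2 : ∀ (q : ℕ) (T : Subgroup (Sym (Fin q))) → Listed q T →
    (τ : Subgroup.Element T → Subgroup.Element T) →
    IsAutomorphism T τ → Outer T τ → ¬ InducedByNormalizer T τ →
    SquaresToIdentity T τ →
    NeighbourTransitive {2 * q} {q} C⟨ T , proj₁ ∷ (proj₁ ∘ τ) ∷ [] ⟩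
theorem4p2 q T listed τ τ-aut _ _ τ²≈id =
  let a , b , a≢b = Listed⇒distinctPoints listed
  in  neighbourTransitive T τ τ-aut τ²≈id (Listed⇒twoTransitive listed) a≢b
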